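{- Assume that $n \geq 4$ and $|A| = 2$. If $f \colon A^n \to B$ is weakly determined by the order of first occurrence, then $f$ is reconstructible.
   Context: $B$ is a set with at least two elements; $n$ is a positive integer. $[n] := \{1,\dots,n\}$, $\binom{[n]}{2}$ denotes the set of all $2$-element subsets of $[n]$, and $\Sigma_n$ is the symmetric group on $[n]$. For $\mathbf{a} \in A^n$ and $\sigma \colon [m] \to [n]$, write $\mathbf{a}\sigma := (a_{\sigma(1)},\dots,a_{\sigma(m)}) \in A^m$. Functions $f, g \colon A^n \to B$ are equivalent, $f \equiv g$, if there is $\sigma \in \Sigma_n$ with $f(\mathbf{a}) = g(\mathbf{a}\sigma)$ for all $\mathbf{a} \in A^n$. For $n \geq 2$, $f \colon A^n \to B$ and $I \in \binom{[n]}{2}$, the identification minor $f_I \colon A^{n-1} \to B$ is given by $f_I(\mathbf{a}) = f(\mathbf{a}\delta_I)$, where $\delta_I \colon [n] \to [n-1]$ is defined by $\delta_I(i) = i$ if $i < \max I$, $\delta_I(i) = \min I$ if $i = \max I$, and $\delta_I(i) = i-1$ if $i > \max I$. The deck of $f$, $\operatorname{deck} f$, is the multiset $\{f_I/{\equiv} : I \in \binom{[n]}{2}\}$ of equivalence classes. A function $g \colon A^n \to B$ is a reconstruction of $f$ if $\operatorname{deck} f = \operatorname{deck} g$. The function $f$ is reconstructible if it is equivalent to all of its reconstructions. Let $A^r_{\neq}$ be the set of $r$-tuples over $A$ with pairwise distinct entries and $A^\sharp := \bigcup_{r \geq 1} A^r_{\neq}$. The map $\operatorname{ofo} \colon \bigcup_{n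 \geq 1} A^n \to A^\sharp$ sends a tuple $\mathbf{a}$ to the tuple listing the distinct elements occurring in $\mathbf{a}$ in the order of their first occurrence. A function $f \colon A^n \to B$ is weakly determined by the order of first occurrence if there exist $f^* \colon A^\sharp \to B$ and $\sigma \in \Sigma_n$ such that $f(\mathbf{a}) = f^*(\operatorname{ofo}(\mathbf{a}\sigma))$ for all $\mathbf{a} \in A^n$. -}

module Defs where

open import Data.Fin using (Fin; _<_; punchOut)
open import Data.Fin.Permutation using (Permutation′; _⟨$⟩ʳ_)
open import Data.Fin.Properties using (_≟_; <⇒≢)
open import Data.List using (deduplicate; filter)
open import Data.List.NonEmpty using (List⁺; _∷_; toList)
open import Data.List.Relation.Unary.Unique.DecPropositional.Properties using (deduplicate-!)
open import Data.List.Relation.Unary.Unique.Propositional using (Unique)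
open import Data.Nat using (ℕ; suc)
open import Data.Product using (Σ-syntax)
open import Data.Vec using (Vec; _∷_; lookup; tabulate)
import Data.List as List
import Data.Vec as Vec
open import Function using (_∘_; _↔_)
open import Function.Bundles using (Inverse)
open import Level using (Level; _⊔_)
open import Relation.Binary.Definitions using (DecidableEquality)
open import Relation.Binary.PropositionalEquality using (_≡_; sym)
open import Relation.Nullary using (yes; no; ¬?)

private
  variable
    a b : Level
    A   : Set a
    B   : Set b
    m n : ℕ

-- Tuples are vectors rather than functions Fin n → A, so that a function of
-- n arguments automatically respects pointwise equality of its arguments.
-- Positions are numbered from 0.

infixl 8 _∙_

_∙_ : Vec A n → (Fin m → Fin n) → Vec A m
𝐚 ∙ σ = tabulate (lookup 𝐚 ∘ σ)

infix 4 _≅_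

_≅_ : {A : Set a} {B : Set b} (f g : Vec A n → B) → Set (a ⊔ b)
_≅_ {n = n} f g = Σ[ σ ∈ Permutation′ n ] (∀ 𝐚 → f 𝐚 ≡ g (𝐚 ∙ (σ ⟨$⟩ʳ_)))

-- A 2-element subset of Fin n, given by its minimum and maximum.  Proofs
-- of min < max are unique, so two pairs with the same elements are equal.

record Pair (n : ℕ) : Set where
  constructor pair
  field
    min max : Fin n
    min<max : min < max

-- punchOut {max} {i} is i for i < max and i - 1 for i > max; in particular it
-- leaves the value of min unchanged.

δ : Pair (suc n) → Fin (suc n) → Fin n
δ (pair min max min<max) i with max ≟ i
... | yes _     = punchOut {i = max} {j = min} (λ max≡min → <⇒≢ min<max (sym max≡min))
... | no  max≢i = punchOut max≢i

minor : (Vec A (suc n) → B) → Pair (suc n) → (Vec A n → B)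
minor f I 𝐚 = f (𝐚 ∙ δ I)

-- The deck is kept as the family of minors indexed by pairs.  Equality of the
-- multisets of equivalence classes of two such families is a reindexing that
-- matches each minor with an equivalent one.

deck : (Vec A (suc n) → B) → (Pair (suc n) → (Vec A n → B))
deck = minor

infix 4 _≋_

_≋_ : {A : Set a} {B : Set b} (F G : Pair m → (Vec A n → B)) → Set (a ⊔ b)
_≋_ {m = m} F G = Σ[ π ∈ Pair m ↔ Pair m ] (∀ I → F I ≅ G (Inverse.to π I))

_IsReconstructionOf_ : {A : Set a} {B : Set b} (g f : Vec A (suc n) → B) → Set (a ⊔ b)
g IsReconstructionOf f = deck f ≋ deck g

Reconstructible : {A : Set a} {B : Set b} (f : Vec A (suc n) → B) → Set (a ⊔ b)
Reconstructible f = ∀ g → g IsReconstructionOf f → f ≅ g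

-- The proof of distinctness is irrelevant, so a function out of A ♯ depends
-- only on the entries.

record _♯ (A : Set a) : Set a where
  constructor tuple
  field
    entries   : List⁺ A
    .distinct : Unique (toList entries)

-- The list of entries is deduplicate _≟_ (x ∷ xs), which keeps the first
-- occurrence of each element; it is unfolded once to expose its head.

ofo : DecidableEquality A → Vec A (suc n) → A ♯
ofo _≟_ (x ∷ 𝐱) = tuple (x ∷ filter (¬? ∘ (x ≟_)) (deduplicate _≟_ xs))
                        (deduplicate-! _≟_ (x List.∷ xs))
  where
  xs = Vec.toList 𝐱

WeaklyDeterminedByOfo : {A : Set a} {B : Set b} → DecidableEquality A →
                        (Vec A (suc n) → B) → Set (a ⊔ b)
WeaklyDeterminedByOfo {n = n} {A = A} {B = B} _≟_ f =
  Σ[ f* ∈ (A ♯ → B) ] Σ[ σ ∈ Permutation′ (suc n) ]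
    (∀ 𝐚 → f 𝐚 ≡ f* (ofo _≟_ (𝐚 ∙ (σ ⟨$⟩ʳ_))))

{-# OPTIONS --safe #-}

-- When |A| = 2, ofo 𝐚 depends only on the first entry of 𝐚 and on whether 𝐚
-- is constant.  So f takes a value c x on the constant tuple (x,…,x) and the
-- value d (a_p) on every other tuple 𝐚, for a fixed position p, the pivot.
-- Every minor of f has the same c and d with some pivot, hence so does every
-- minor of a reconstruction g.  Thus every 2-subset I has a position q(I) with
-- g 𝐚 = d (a_q(I)) for all non-constant 𝐚 that are constant on I.  If a
-- 2-colouring of the positions is constant on I and on J but separates q(I)
-- from q(J), then d is constant and any position is a pivot of g.  Since there
-- are at least four positions, {0,1} and {2,3} are disjoint, so either this
-- happens or p = q(I) ∉ I for one of them.  In the latter case p is a pivot of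
-- g: whenever a_q(J) ≠ a_p, some 2-colouring separates two of the q's.  Equality
-- in B never has to be decided.

module Submission where

open import Defs
import Data.List as List
import Data.Vec as Vec
open import Data.Bool using (if_then_else_)
open import Data.Fin using (Fin; zero; suc; opposite; punchIn; punchOut; _<_)
open import Data.Fin.Patterns using (0F; 1F; 2F; 3F)
open import Data.Fin.Permutation as Perm using (_⟨$⟩ʳ_; _⟨$⟩ˡ_)
open import Data.Fin.Properties
  using (_≟_; inj⇒≟; all?; ¬∀⟶∃¬; pigeonhole; <⇒≢; <-cmp; punchInᵢ≢i;
         punchIn-punchOut; punchOut-punchIn; punchOut-cong)
open import Data.List using (List; []; _∷_; [_]; length; deduplicate; filter)
open import Data.List.Membership.DecPropositional using (_∈?_)
open import Data.List.Membership.Propositional using (_∈_; _∉_)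
open import Data.List.Membership.Propositional.Properties
  using (∈-filter⁺; ∈-filter⁻; ∈-deduplicate⁺; ∈-deduplicate⁻)
open import Data.List.NonEmpty using (_∷_)
open import Data.List.Properties using (filter-none)
open import Data.List.Relation.Unary.All using ([]; _∷_; tabulate)
open import Data.List.Relation.Unary.All.Properties using (All¬⇒¬Any)
open import Data.List.Relation.Unary.AllPairs using ([]; _∷_)
open import Data.List.Relation.Unary.Any using (here; there; index)
open import Data.List.Relation.Unary.Any.Properties using (lookup-index)
open import Data.List.Relation.Unary.Unique.DecPropositional.Properties using (deduplicate-!)
open import Data.List.Relation.Unary.Unique.Propositional using (Unique)
open import Data.List.Relation.Unary.Unique.Propositional.Properties using (filter⁺)
open import Data.Nat as ℕ using (ℕ; suc; _≤_; z≤n; s≤s)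
open import Data.Nat.Properties using (<-trans; ≤-refl)
open import Data.Product using (∃; ∃₂; _×_; _,_; proj₁; proj₂)
open import Data.Sum using (_⊎_; inj₁; inj₂)
open import Data.Vec using (Vec; _∷_; lookup; toList)
open import Data.Vec.Membership.Propositional.Properties
  using (∈-lookup; ∈-toList⁺; ∈-toList⁻)
open import Data.Vec.Properties using (lookup∘tabulate; tabulate∘lookup; tabulate-cong)
import Data.Vec.Relation.Unary.Any as VecAny
import Data.Vec.Relation.Unary.Any.Properties as VecAny
open import Function using (_↔_; _∘_; Inverse)
open import Function.Definitions using (StrictlySurjective)
open import Function.Properties.Inverse using (↔⇒↣)
open import Level using (Level; _⊔_)
open import Relation.Binary.Definitions using (DecidableEquality; tri<; tri≈; tri>)
open import Relation.Binary.PropositionalEquality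
  using (_≡_; _≢_; _≗_; refl; sym; trans; cong; subst; ≢-sym)
open import Relation.Nullary using (yes; no; does; ¬?; contradiction)
open import Relation.Nullary.Decidable using (dec-true; dec-false)

private
  variable
    a b : Level
    A   : Set a
    B   : Set b
    m n : ℕ

-- Reindexed tuples and identification minors

lookup-∙ : (𝐚 : Vec A n) (σ : Fin m → Fin n) → ∀ i → lookup (𝐚 ∙ σ) i ≡ lookup 𝐚 (σ i)
lookup-∙ 𝐚 σ = lookup∘tabulate (lookup 𝐚 ∘ σ)

-- `σ ∘ τ` need not be the identity: for `punchIn` after `δ` it moves `max` to `min`, which is
-- harmless when the two entries agree.
∙-retract : (𝐚 : Vec A n) (σ : Fin m → Fin n) (τ : Fin n → Fin m) →
            (∀ i → lookup 𝐚 (σ (τ i)) ≡ lookup 𝐚 i) → 𝐚 ∙ σ ∙ τ ≡ 𝐚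
∙-retract 𝐚 σ τ στ≗id = trans
  (tabulate-cong (λ i → trans (lookup-∙ 𝐚 σ (τ i)) (στ≗id i)))
  (tabulate∘lookup 𝐚)

δ-punchIn : (I : Pair (suc n)) → ∀ i → δ I (punchIn (Pair.max I) i) ≡ i
δ-punchIn (pair min max min<max) i with max ≟ punchIn max i
... | yes eq    = contradiction (sym eq) (punchInᵢ≢i max i)
... | no  max≢i = trans (punchOut-cong max refl) (punchOut-punchIn max)

δ-surjective : (I : Pair (suc n)) → StrictlySurjective _≡_ (δ I)
δ-surjective I i = punchIn (Pair.max I) i , δ-punchIn I i

-- The entry at `max` is deleted and then refilled by a copy of the entry at `min`. So the minor at
-- `I` gives the value of the function at every tuple that is constant on `I`.
∙-punchIn-∙-δ : (𝐚 : Vec A (suc n)) (I : Pair (suc n)) →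
                lookup 𝐚 (Pair.min I) ≡ lookup 𝐚 (Pair.max I) →
                𝐚 ∙ punchIn (Pair.max I) ∙ δ I ≡ 𝐚
∙-punchIn-∙-δ 𝐚 I@(pair min max min<max) aₘᵢₙ≡aₘₐₓ = ∙-retract 𝐚 (punchIn max) (δ I) retract
  where
  retract : ∀ i → lookup 𝐚 (punchIn max (δ I i)) ≡ lookup 𝐚 i
  retract i with max ≟ i
  ... | yes refl  = trans (cong (lookup 𝐚) (punchIn-punchOut _)) aₘᵢₙ≡aₘₐₓ
  ... | no  max≢i = cong (lookup 𝐚) (punchIn-punchOut max≢i)

-- Finite lists

Unique-singleton : ∀ {x : A} {xs} → Unique xs → (∀ {y} → y ∈ xs → y ≡ x) → x ∈ xs → xs ≡ [ x ]
Unique-singleton {xs = y ∷ []}     _             ≡x _ = cong [_] (≡x (here refl))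
Unique-singleton {xs = y ∷ z ∷ xs} ((y≢z ∷ _) ∷ _) ≡x _ =
  contradiction (trans (≡x (here refl)) (sym (≡x (there (here refl))))) y≢z

-- Otherwise `index` would send the `n` positions to fewer places of `xs`, and two positions with
-- the same place are equal.
fresh : (xs : List (Fin n)) → length xs ℕ.< n → ∃ (_∉ xs)
fresh xs |xs|<n = ¬∀⟶∃¬ _ (_∈ xs) (λ i → _∈?_ _≟_ i xs) λ all∈ →
  let i , j , i<j , same = pigeonhole |xs|<n (index ∘ all∈)
  in <⇒≢ i<j (trans (lookup-index (all∈ i))
             (trans (cong (List.lookup xs) same) (sym (lookup-index (all∈ j)))))

-- Constant and non-constant tuples

Constant : Vec A n → A → Set _
Constant 𝐚 x = ∀ i → lookup 𝐚 i ≡ x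

NonConstant : Vec A n → Set _
NonConstant 𝐚 = ∃₂ λ i j → lookup 𝐚 i ≢ lookup 𝐚 j

constant? : DecidableEquality A → (𝐚 : Vec A (suc n)) → ∃ (Constant 𝐚) ⊎ NonConstant 𝐚
constant? _≟ᴬ_ 𝐚 with all? (λ i → lookup 𝐚 i ≟ᴬ lookup 𝐚 zero)
... | yes const = inj₁ (lookup 𝐚 zero , const)
... | no ¬const = let i , aᵢ≢a₀ = ¬∀⟶∃¬ _ _ (λ i → lookup 𝐚 i ≟ᴬ lookup 𝐚 zero) ¬const
                  in inj₂ (i , zero , aᵢ≢a₀)

Constant-∙ : ∀ {x} (𝐚 : Vec A n) (σ : Fin m → Fin n) → Constant 𝐚 x → Constant (𝐚 ∙ σ) x
Constant-∙ 𝐚 σ const i = trans (lookup-∙ 𝐚 σ i) (const (σ i))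

NonConstant-∙ : (𝐚 : Vec A n) {σ : Fin m → Fin n} → StrictlySurjective _≡_ σ →
                NonConstant 𝐚 → NonConstant (𝐚 ∙ σ)
NonConstant-∙ 𝐚 {σ} surj (i , j , aᵢ≢aⱼ) with surj i | surj j
... | i′ , refl | j′ , refl = i′ , j′ , λ eq →
  aᵢ≢aⱼ (trans (sym (lookup-∙ 𝐚 σ i′)) (trans eq (lookup-∙ 𝐚 σ j′)))

NonConstant-∙⁻ : (𝐚 : Vec A n) (σ : Fin m → Fin n) → NonConstant (𝐚 ∙ σ) → NonConstant 𝐚
NonConstant-∙⁻ 𝐚 σ (i , j , neq) = σ i , σ j , λ eq →
  neq (trans (lookup-∙ 𝐚 σ i) (trans eq (sym (lookup-∙ 𝐚 σ j))))

-- Functions with a pivot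

record Pivot {A : Set a} {B : Set b} (c d : A → B) (p : Fin n) (f : Vec A n → B) : Set (a ⊔ b) where
  field
    constant    : ∀ 𝐚 {x} → Constant 𝐚 x → f 𝐚 ≡ c x
    nonConstant : ∀ 𝐚 → NonConstant 𝐚 → f 𝐚 ≡ d (lookup 𝐚 p)

open Pivot

module _ {A : Set a} {B : Set b} {c d : A → B} where

  Pivot-cong : ∀ {p} {f g : Vec A n → B} → g ≗ f → Pivot c d p f → Pivot c d p g
  Pivot-cong g≗f P .constant    𝐚 const = trans (g≗f 𝐚) (P .constant 𝐚 const)
  Pivot-cong g≗f P .nonConstant 𝐚 nc    = trans (g≗f 𝐚) (P .nonConstant 𝐚 nc)

  -- Surjectivity keeps non-constant tuples non-constant. Permutations and `δ I` are surjective, so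
  -- minors and equivalent functions inherit `c` and `d`, and only the pivot moves.
  Pivot-∙ : ∀ {p} {f : Vec A m → B} (σ : Fin m → Fin n) → StrictlySurjective _≡_ σ →
            Pivot c d p f → Pivot c d (σ p) (λ 𝐚 → f (𝐚 ∙ σ))
  Pivot-∙         σ surj P .constant    𝐚 const = P .constant (𝐚 ∙ σ) (Constant-∙ 𝐚 σ const)
  Pivot-∙ {p = p} σ surj P .nonConstant 𝐚 nc    =
    trans (P .nonConstant (𝐚 ∙ σ) (NonConstant-∙ 𝐚 surj nc)) (cong d (lookup-∙ 𝐚 σ p))

  Pivot-minor : ∀ {p} {f : Vec A (suc n) → B} → Pivot c d p f → ∀ I → Pivot c d (δ I p) (minor f I)
  Pivot-minor P I = Pivot-∙ (δ I) (δ-surjective I) P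

  Pivot-≅ : ∀ {p} {f g : Vec A n → B} → Pivot c d p f → f ≅ g → ∃ λ q → Pivot c d q g
  Pivot-≅ {p = p} {f} {g} P (σ , f≗gσ) =
    σ ⟨$⟩ˡ p , Pivot-cong g≗fσ⁻¹ (Pivot-∙ (σ ⟨$⟩ˡ_) (λ i → σ ⟨$⟩ʳ i , Perm.inverseˡ σ) P)
    where
    g≗fσ⁻¹ : ∀ 𝐚 → g 𝐚 ≡ f (𝐚 ∙ (σ ⟨$⟩ˡ_))
    g≗fσ⁻¹ 𝐚 = trans
      (cong g (sym (∙-retract 𝐚 (σ ⟨$⟩ˡ_) (σ ⟨$⟩ʳ_) (λ i → cong (lookup 𝐚) (Perm.inverseˡ σ)))))
      (sym (f≗gσ (𝐚 ∙ (σ ⟨$⟩ˡ_))))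

  Pivot⇒≅ : DecidableEquality A → ∀ {p q} {f g : Vec A (suc n) → B} →
            Pivot c d p f → Pivot c d q g → f ≅ g
  Pivot⇒≅ _≟ᴬ_ {p} {q} {f} {g} P Q = σ , f≗gσ
    where
    -- Swapping the pivots makes `p` the pivot on both sides.
    σ = Perm.transpose q p

    Qσ : Pivot c d p (λ 𝐚 → g (𝐚 ∙ (σ ⟨$⟩ʳ_)))
    Qσ = subst (λ r → Pivot c d r (λ 𝐚 → g (𝐚 ∙ (σ ⟨$⟩ʳ_)))) σq≡p
           (Pivot-∙ (σ ⟨$⟩ʳ_) (λ i → σ ⟨$⟩ˡ i , Perm.inverseʳ σ) Q)
      where
      σq≡p : σ ⟨$⟩ʳ q ≡ p
      σq≡p rewrite dec-true (q ≟ q) refl = refl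

    f≗gσ : ∀ 𝐚 → f 𝐚 ≡ g (𝐚 ∙ (σ ⟨$⟩ʳ_))
    f≗gσ 𝐚 with constant? _≟ᴬ_ 𝐚
    ... | inj₁ (x , const) = trans (P .constant 𝐚 const) (sym (Qσ .constant 𝐚 const))
    ... | inj₂ nc          = trans (P .nonConstant 𝐚 nc) (sym (Qσ .nonConstant 𝐚 nc))

-- Order of first occurrence over two letters

module _ {a} {A : Set a} (A↔2 : A ↔ Fin 2) where

  open Inverse A↔2 using (to; from; strictlyInverseˡ)

  private
    infix 4 _≟ᴬ_
    _≟ᴬ_ : DecidableEquality A
    _≟ᴬ_ = inj⇒≟ (↔⇒↣ A↔2)

    to-injective : ∀ {x y} → to x ≡ to y → x ≡ y
    to-injective {x} {y} eq = trans (sym (Inverse.strictlyInverseʳ A↔2 x))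
      (trans (cong from eq) (Inverse.strictlyInverseʳ A↔2 y))

    opposite≢ : (i : Fin 2) → i ≢ opposite i
    opposite≢ 0F ()
    opposite≢ 1F ()

    ≢⇒opposite : (i j : Fin 2) → j ≢ i → j ≡ opposite i
    ≢⇒opposite 0F 0F neq = contradiction refl neq
    ≢⇒opposite 0F 1F neq = refl
    ≢⇒opposite 1F 0F neq = refl
    ≢⇒opposite 1F 1F neq = contradiction refl neq

  other : A → A
  other x = from (opposite (to x))

  ≢other : ∀ x → x ≢ other x
  ≢other x eq = opposite≢ (to x) (trans (cong to eq) (strictlyInverseˡ _))

  ≢⇒other : ∀ {x y} → y ≢ x → y ≡ other x
  ≢⇒other {x} {y} y≢x = to-injective
    (trans (≢⇒opposite (to x) (to y) (y≢x ∘ to-injective)) (sym (strictlyInverseˡ _)))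

  private
    tuple-cong : ∀ {x : A} {ys zs} .{u v} → ys ≡ zs → tuple (x ∷ ys) u ≡ tuple (x ∷ zs) v
    tuple-cong refl = refl

  ofo-constant : ∀ {x} (𝐚 : Vec A (suc n)) → Constant 𝐚 x → ofo _≟ᴬ_ 𝐚 ≡ tuple (x ∷ []) ([] ∷ [])
  ofo-constant (x ∷ 𝐱) const with refl ← const zero =
    tuple-cong (filter-none (¬? ∘ (x ≟ᴬ_)) (tabulate λ z∈ x≢z →
      let z∈𝐱 = ∈-toList⁻ (∈-deduplicate⁻ _≟ᴬ_ (toList 𝐱) z∈)
      in x≢z (sym (trans (VecAny.lookup-index z∈𝐱) (const (suc (VecAny.index z∈𝐱)))))))

  -- Only one letter can follow the first, and it does occur, since of two unequal entries at least
  -- one differs from the head. Distinctness then leaves a one-element tail.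
  ofo-nonConstant : (𝐚 : Vec A (suc n)) → NonConstant 𝐚 →
                    ofo _≟ᴬ_ 𝐚 ≡ tuple (lookup 𝐚 zero ∷ [ other (lookup 𝐚 zero) ])
                                       ((≢other (lookup 𝐚 zero) ∷ []) ∷ [] ∷ [])
  ofo-nonConstant (x ∷ 𝐱) (i , j , aᵢ≢aⱼ) = tuple-cong (Unique-singleton
    (filter⁺ (¬? ∘ (x ≟ᴬ_)) (deduplicate-! _≟ᴬ_ (toList 𝐱)))
    (λ z∈ → ≢⇒other (≢-sym (proj₂ (∈-filter⁻ (¬? ∘ (x ≟ᴬ_)) {xs = deduplicate _≟ᴬ_ (toList 𝐱)} z∈))))
    (∈-filter⁺ (¬? ∘ (x ≟ᴬ_)) (∈-deduplicate⁺ _≟ᴬ_ other∈) (≢other x)))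
    where
    occurs : ∀ k → lookup (x ∷ 𝐱) k ≢ x → other x ∈ toList 𝐱
    occurs zero    x≢x  = contradiction refl x≢x
    occurs (suc k) aₖ≢x = subst (_∈ toList 𝐱) (≢⇒other aₖ≢x) (∈-toList⁺ (∈-lookup k 𝐱))

    other∈ : other x ∈ toList 𝐱
    other∈ with lookup (x ∷ 𝐱) i ≟ᴬ x
    ... | no  aᵢ≢x = occurs i aᵢ≢x
    ... | yes aᵢ≡x = occurs j (λ aⱼ≡x → aᵢ≢aⱼ (trans aᵢ≡x (sym aⱼ≡x)))

  WeaklyDeterminedByOfo⇒Pivot : ∀ {b} {B : Set b} {f : Vec A (suc n) → B} →
    WeaklyDeterminedByOfo _≟ᴬ_ f → ∃₂ λ c d → ∃ λ p → Pivot c d p f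
  WeaklyDeterminedByOfo⇒Pivot (f* , σ , f≗f*ofoσ) = c , d , _ , Pivot-cong f≗f*ofoσ
    (Pivot-∙ (σ ⟨$⟩ʳ_) (λ i → σ ⟨$⟩ˡ i , Perm.inverseʳ σ) f*∘ofo)
    where
    c d : A → _
    c x = f* (tuple (x ∷ []) ([] ∷ []))
    d x = f* (tuple (x ∷ [ other x ]) ((≢other x ∷ []) ∷ [] ∷ []))

    f*∘ofo : Pivot c d zero (f* ∘ ofo _≟ᴬ_)
    f*∘ofo .constant    𝐚 const = cong f* (ofo-constant 𝐚 const)
    f*∘ofo .nonConstant 𝐚 nc    = cong f* (ofo-nonConstant 𝐚 nc)

  -- Pivots on pairs and two-colourings of the positions

  module _ {b} {B : Set b} (d : A → B) (g : Vec A n → B) where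

    -- What a pivot of the minor at `{i,j}` says about `g`, expressed in positions of `g` itself.
    PivotOn : Fin n → Fin n → Fin n → Set _
    PivotOn i j q = ∀ 𝐚 → lookup 𝐚 i ≡ lookup 𝐚 j → NonConstant 𝐚 → g 𝐚 ≡ d (lookup 𝐚 q)

    PivotOn-sym : ∀ {i j q} → PivotOn i j q → PivotOn j i q
    PivotOn-sym Q 𝐚 aⱼ≡aᵢ = Q 𝐚 (sym aⱼ≡aᵢ)

    Monochromatic : List (Fin n) → Fin n → Fin n → Set
    Monochromatic xs i j = (i ∈ xs × j ∈ xs) ⊎ (i ∉ xs × j ∉ xs)

    -- Colour `xs` with `x` and the rest with `other x`. Both pairs are monochromatic, so both
    -- pivots evaluate `g` at this tuple, one to `d x` and the other to `d (other x)`.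
    conflict : ∀ xs {i j q i′ j′ q′} → PivotOn i j q → PivotOn i′ j′ q′ →
               Monochromatic xs i j → Monochromatic xs i′ j′ → q ∈ xs → q′ ∉ xs →
               ∀ x → d x ≡ d (other x)
    conflict xs {q = q} {q′ = q′} Q Q′ mono mono′ q∈ q′∉ x =
      trans (sym (trans (Q 𝐚 (same mono) nc) (cong d (inside q∈))))
                 (trans (Q′ 𝐚 (same mono′) nc) (cong d (outside q′∉)))
      where
      colour : Fin n → A
      colour k = if does (_∈?_ _≟_ k xs) then x else other x

      𝐚 : Vec A n
      𝐚 = Vec.tabulate colour

      inside : ∀ {k} → k ∈ xs → lookup 𝐚 k ≡ x
      inside {k} k∈ = trans (lookup∘tabulate colour k)
        (cong (if_then x else other x) (dec-true (_∈?_ _≟_ k xs) k∈))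

      outside : ∀ {k} → k ∉ xs → lookup 𝐚 k ≡ other x
      outside {k} k∉ = trans (lookup∘tabulate colour k)
        (cong (if_then x else other x) (dec-false (_∈?_ _≟_ k xs) k∉))

      same : ∀ {k l} → Monochromatic xs k l → lookup 𝐚 k ≡ lookup 𝐚 l
      same (inj₁ (k∈ , l∈)) = trans (inside k∈) (sym (inside l∈))
      same (inj₂ (k∉ , l∉)) = trans (outside k∉) (sym (outside l∉))

      nc : NonConstant 𝐚
      nc = q , q′ , λ eq → ≢other x (trans (sym (inside q∈)) (trans eq (outside q′∉)))

    ≡other⇒≡ : (∀ x → d x ≡ d (other x)) → ∀ x y → d x ≡ d y
    ≡other⇒≡ dx≡ x y with y ≟ᴬ x
    ... | yes refl = refl
    ... | no  y≢x  = trans (dx≡ x) (cong d (sym (≢⇒other y≢x)))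

    module _ (3<n : 3 ℕ.< n) (pivotOn : ∀ {i j} → i ≢ j → ∃ (PivotOn i j)) where

      -- More than two positions must repeat a letter, so every tuple is constant on some pair,
      -- whose pivot evaluates `g`.
      nonConstant-at : ∀ p → (∀ {i j q} → PivotOn i j q → ∀ 𝐚 → lookup 𝐚 i ≡ lookup 𝐚 j →
                              d (lookup 𝐚 q) ≡ d (lookup 𝐚 p)) →
                       ∀ {𝐚} → NonConstant 𝐚 → g 𝐚 ≡ d (lookup 𝐚 p)
      nonConstant-at p agree {𝐚} nc =
        let i , j , i<j , eq = pigeonhole (<-trans ≤-refl 3<n) (to ∘ lookup 𝐚)
            q , Q            = pivotOn (<⇒≢ i<j)
            aᵢ≡aⱼ            = to-injective eq
        in trans (Q 𝐚 aᵢ≡aⱼ nc) (agree Q 𝐚 aᵢ≡aⱼ)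

      -- The class `{p}` misses both pairs and separates `p` from `q`.
      conflict-disjoint : ∀ {i j p k l q} → PivotOn i j p → p ≢ i → p ≢ j →
                          PivotOn k l q → p ≢ k → p ≢ l → q ≢ p → ∀ x → d x ≡ d (other x)
      conflict-disjoint {p = p} P p≢i p≢j Q p≢k p≢l q≢p = conflict [ p ] P Q
        (inj₂ (∉[p] p≢i , ∉[p] p≢j)) (inj₂ (∉[p] p≢k , ∉[p] p≢l)) (here refl) (∉[p] (≢-sym q≢p))
        where
        ∉[p] : ∀ {k} → p ≢ k → k ∉ [ p ]
        ∉[p] p≢k = All¬⇒¬Any (≢-sym p≢k ∷ [])

      conflict-meeting : ∀ {i j p q} → i ≢ j → PivotOn i j p → p ≢ i → p ≢ j →
                         PivotOn p i q → q ≢ p → q ≢ i → ∀ x → d x ≡ d (other x)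
      conflict-meeting {i} {j} {p} {q} i≢j P p≢i p≢j Q q≢p q≢i with q ≟ j
      -- The class `{p,i,j}` contains both pairs and `p`, but not `q`.
      ... | no q≢j = conflict (p ∷ i ∷ j ∷ []) P Q
        (inj₁ (there (here refl) , there (there (here refl)))) (inj₁ (here refl , there (here refl)))
        (here refl) (All¬⇒¬Any (q≢p ∷ q≢i ∷ q≢j ∷ []))
      -- Here {i,j} has pivot p and {p,i} has pivot j; a fourth position k
      -- decides, since the pivot of {i,k} can agree with at most one of them.
      ... | yes refl with k , k∉ ← fresh (p ∷ i ∷ j ∷ []) 3<n
                        with r , R ← pivotOn {i} {k} (λ i≡k → k∉ (there (here (sym i≡k))))
                        with r ≟ p
      ...   | no  r≢p  = conflict-disjoint P p≢i p≢j R p≢i (λ p≡k → k∉ (here (sym p≡k))) r≢p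
      ...   | yes refl = conflict [ j ] Q R
        (inj₂ (All¬⇒¬Any (p≢j ∷ []) , All¬⇒¬Any (i≢j ∷ [])))
        (inj₂ (All¬⇒¬Any (i≢j ∷ []) , λ { (here k≡j) → k∉ (there (there (here k≡j))) }))
        (here refl) (All¬⇒¬Any (p≢j ∷ []))

      -- If `l` is neither `i` nor `j`, the class `{p,l}` contains one pair, misses the other and
      -- separates `p` from `q`. Otherwise the pairs share a position.
      conflict-incident : ∀ {i j p l q} → i ≢ j → PivotOn i j p → p ≢ i → p ≢ j →
                          PivotOn p l q → q ≢ p → q ≢ l → ∀ x → d x ≡ d (other x)
      conflict-incident {i} {j} {p} {l} i≢j P p≢i p≢j Q q≢p q≢l with i ≟ l | j ≟ l
      ... | yes refl | _        = conflict-meeting i≢j P p≢i p≢j Q q≢p q≢l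
      ... | no  _    | yes refl = conflict-meeting (≢-sym i≢j) (PivotOn-sym P) p≢j p≢i Q q≢p q≢l
      ... | no  i≢l  | no  j≢l  = conflict (p ∷ l ∷ []) P Q
        (inj₂ (All¬⇒¬Any (≢-sym p≢i ∷ i≢l ∷ []) , All¬⇒¬Any (≢-sym p≢j ∷ j≢l ∷ [])))
        (inj₁ (here refl , there (here refl)))
        (here refl) (All¬⇒¬Any (q≢p ∷ q≢l ∷ []))

      nonConstant-at-pivotOn : ∀ {i j p} → i ≢ j → PivotOn i j p → p ∉ i ∷ j ∷ [] →
                               ∀ {𝐚} → NonConstant 𝐚 → g 𝐚 ≡ d (lookup 𝐚 p)
      nonConstant-at-pivotOn {i} {j} {p} i≢j P p∉ = nonConstant-at p agree
        where
        p≢i : p ≢ i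
        p≢i = p∉ ∘ here

        p≢j : p ≢ j
        p≢j = p∉ ∘ there ∘ here

        agree : ∀ {k l q} → PivotOn k l q → ∀ 𝐚 → lookup 𝐚 k ≡ lookup 𝐚 l →
                d (lookup 𝐚 q) ≡ d (lookup 𝐚 p)
        agree {k} {l} {q} Q 𝐚 aₖ≡aₗ with lookup 𝐚 q ≟ᴬ lookup 𝐚 p
        ... | yes a_q≡a_p = cong d a_q≡a_p
        ... | no  a_q≢a_p = ≡other⇒≡ conflicting _ _
          where
          -- A position with the same letter as `p` cannot be `q`. If `p` lies in `{k,l}`, both
          -- members have that letter, so `q` lies outside the pair.
          q≢ : ∀ {r} → lookup 𝐚 r ≡ lookup 𝐚 p → q ≢ r
          q≢ a_r≡a_p refl = a_q≢a_p a_r≡a_p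

          conflicting : ∀ x → d x ≡ d (other x)
          conflicting with p ≟ k | p ≟ l
          ... | yes refl | _        =
            conflict-incident i≢j P p≢i p≢j Q (q≢ refl) (q≢ (sym aₖ≡aₗ))
          ... | no  _    | yes refl =
            conflict-incident i≢j P p≢i p≢j (PivotOn-sym Q) (q≢ refl) (q≢ aₖ≡aₗ)
          ... | no  p≢k  | no  p≢l  =
            conflict-disjoint P p≢i p≢j Q p≢k p≢l (q≢ refl)

      nonConstant-pivot : ∀ {i j k l} → i ≢ j → k ≢ l → k ∉ i ∷ j ∷ [] → l ∉ i ∷ j ∷ [] →
                          ∃ λ p → ∀ {𝐚} → NonConstant 𝐚 → g 𝐚 ≡ d (lookup 𝐚 p)
      nonConstant-pivot {i} {j} {k} {l} i≢j k≢l k∉ l∉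
        with p , P ← pivotOn i≢j | q , Q ← pivotOn k≢l
        with _∈?_ _≟_ p (i ∷ j ∷ []) | _∈?_ _≟_ q (k ∷ l ∷ [])
      ... | no  p∉ | _      = p , nonConstant-at-pivotOn i≢j P p∉
      ... | yes _  | no  q∉ = q , nonConstant-at-pivotOn k≢l Q q∉
      -- Each pivot lies in its own pair, so the class `{i,j}` separates them. As `d` is then
      -- constant, the choice of `p` is arbitrary.
      ... | yes p∈ | yes q∈ = p , nonConstant-at p (λ _ _ _ → ≡other⇒≡ conflicting _ _)
        where
        q∉ : ∀ {r} → r ∈ k ∷ l ∷ [] → r ∉ i ∷ j ∷ []
        q∉ (here refl)         = k∉
        q∉ (there (here refl)) = l∉

        conflicting : ∀ x → d x ≡ d (other x)
        conflicting = conflict (i ∷ j ∷ []) P Q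
          (inj₁ (here refl , there (here refl))) (inj₂ (k∉ , l∉)) p∈ (q∉ q∈)

  -- From the minors to the whole function

  minors⇒Pivot : ∀ {b} {B : Set b} {c d : A → B} {g : Vec A (suc n) → B} → 4 ≤ suc n →
                 (∀ I → ∃ λ q → Pivot c d q (minor g I)) → ∃ λ p → Pivot c d p g
  minors⇒Pivot {n} {c = c} {d} {g} 3<n@(s≤s (s≤s (s≤s (s≤s z≤n)))) minors =
    proj₁ pivot , λ where
      -- A constant tuple is constant on every pair, so a single minor gives its value.
      .constant 𝐚 const →
        trans (cong g (sym (∙-punchIn-∙-δ 𝐚 I₀₁ (trans (const 0F) (sym (const 1F))))))
              (proj₂ (minors I₀₁) .constant (𝐚 ∙ punchIn 1F) (Constant-∙ 𝐚 (punchIn 1F) const))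
      .nonConstant _ nc → proj₂ pivot nc
    where
    I₀₁ : Pair (suc n)
    I₀₁ = pair 0F 1F (s≤s z≤n)

    pivotOn< : ∀ {i j} → i < j → ∃ (PivotOn d g i j)
    -- The positions of the minor are numbered as if `j` were deleted; `punchIn j` restores the
    -- numbering of `g`.
    pivotOn< {i} {j} i<j = punchIn j q , λ 𝐚 aᵢ≡aⱼ nc →
      let 𝐚′δ≡𝐚 = ∙-punchIn-∙-δ 𝐚 I aᵢ≡aⱼ
      in trans (cong g (sym 𝐚′δ≡𝐚))
        (trans (Q .nonConstant (𝐚 ∙ punchIn j)
                 -- `δ I` recovers `𝐚` from the shortened tuple, which therefore cannot be constant.
                 (NonConstant-∙⁻ (𝐚 ∙ punchIn j) (δ I) (subst NonConstant (sym 𝐚′δ≡𝐚) nc)))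
               (cong d (lookup-∙ 𝐚 (punchIn j) q)))
      where
      I = pair i j i<j
      q = proj₁ (minors I)
      Q = proj₂ (minors I)

    pivotOn : ∀ {i j} → i ≢ j → ∃ (PivotOn d g i j)
    pivotOn {i} {j} i≢j with <-cmp i j
    ... | tri< i<j _ _ = pivotOn< i<j
    ... | tri≈ _ i≡j _ = contradiction i≡j i≢j
    ... | tri> _ _ j<i = let q , Q = pivotOn< j<i in q , PivotOn-sym d g Q

    pivot : ∃ λ p → ∀ {𝐚} → NonConstant 𝐚 → g 𝐚 ≡ d (lookup 𝐚 p)
    pivot = nonConstant-pivot d g 3<n pivotOn {0F} {1F} {2F} {3F} (λ ()) (λ ())
      (λ { (here ()) ; (there (here ())) ; (there (there ())) })
      (λ { (here ()) ; (there (here ())) ; (there (there ())) })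

corollary6p3 : ∀ {a b} {A : Set a} {B : Set b} →
    (∃₂ λ (x y : B) → x ≢ y) →
    (A↔2 : A ↔ Fin 2) →
    (n : ℕ) → 4 ≤ suc n →
    (f : Vec A (suc n) → B) →
    WeaklyDeterminedByOfo (inj⇒≟ (↔⇒↣ A↔2)) f →
    Reconstructible f
corollary6p3 _ A↔2 n 4≤n f f-ofo g (π , minors≅) =
  let c , d , p , P = WeaklyDeterminedByOfo⇒Pivot A↔2 f-ofo
      -- `π` leads from minors of `f` to minors of `g`, so the minor of `g` at `I` is compared with
      -- that of `f` at the preimage of `I`.
      q , Q         = minors⇒Pivot A↔2 {g = g} 4≤n λ I →
        Pivot-≅ {g = minor g I} (Pivot-minor P (Inverse.from π I))
          (subst (λ J → minor f (Inverse.from π I) ≅ minor g J) (Inverse.strictlyInverseˡ π I)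
                 (minors≅ (Inverse.from π I)))
  in Pivot⇒≅ (inj⇒≟ (↔⇒↣ A↔2)) P Q
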